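{- (Recursion Theorem) Let $A\subseteq\omega$ be an infinite c.e. set and, for every $n\ge1$, let $\theta^{(n)}$ be a quasi-Gödel numbering of $\mathcal S^{(n)}_A$. Let $m,n\ge1$ and $f\in\mathcal R^{(m+1)}$. Then there is a function $e_f\in\mathcal R^{(m)}$ such that for all $\vec y\in\omega^m$, $$\theta^{(n)}_{f(e_f(\vec y),\vec y)}=\theta^{(n)}_{e_f(\vec y)}.$$
   Context: $\omega$ is the set of natural numbers; $\mathcal R^{(n)}$ is the set of total computable functions $\omega^n\to\omega$. $\langle\cdot,\cdot\rangle:\omega^2\to\omega$ is a computable bijection with $\langle x,y\rangle\ge x,y$, extended by $\langle x\rangle=x$, $\langle x_1,\dots,x_{n+1}\rangle=\langle x_1,\langle x_2,\dots,x_{n+1}\rangle\rangle$. $\mathrm{Anf}^{(n)}_A$ is the set of partial functions from $\omega^n$ to $\omega$ whose domain is either empty or equal to $\{0,\dots,a-1\}^n$ for some $a\in A$, and $\mathcal S^{(n)}_A=\mathcal R^{(n)}\cup\mathrm{Anf}^{(n)}_A$. The extended graph of an $n$-ary partial function $q$ is $\{\langle\langle\vec y\rangle,0\rangle:\vec y\in\omega^n\}\cup\{\langle\langle\vec x\rangle,q(\vec x)+1\rangle:\vec x\in\mathrm{dom}(q)\}$. A numbering of a set $X$ is a surjection $\omega\to X$. A numbering $\theta$ of $\mathcal S^{(n)}_A$ is a quasi-Gödel numbering if: (QGN I) the extended graph of $(i,\vec x)\mapsto\theta_i(\vec x)$ is the range of a function in $\mathcal R^{(1)}$; and (QGN II)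 for every $k\in\mathcal R^{(2)}$ there is $v\in\mathcal R^{(1)}$ such that for all $i\in\omega$, $r\in\mathcal S^{(n)}_A$: if $\{k(i,t):t\in\omega\}$ is the extended graph of $r$, then $r=\theta_{v(i)}$. -}

module Defs where

open import Data.Fin.Base using (Fin)
open import Data.Nat.Base using (ℕ; zero; suc; _≤_; _<_)
open import Data.Product.Base using (_×_; _,_; Σ-syntax; ∃-syntax; uncurry)
open import Data.Sum.Base using (_⊎_)
open import Data.Vec.Base using (Vec; []; _∷_; lookup)
open import Data.Vec.Relation.Binary.Pointwise.Inductive using (Pointwise)
open import Data.Vec.Relation.Unary.All using (All)
open import Function.Bundles using (_⇔_)
open import Function.Definitions using (Bijective; Surjective)
open import Level using (0ℓ)
open import Relation.Binary.PropositionalEquality.Core using (_≡_)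
open import Relation.Unary using (Pred; Empty; _∪_; _≐_)

-- Computability: Kleene's partial recursive functions, as terms with a
-- big-step semantics; c [ xs ]⇓ y means that c converges on xs with value y.

data Code : ℕ → Set where
  zeroᶜ : ∀ {n} → Code n
  sucᶜ  : Code 1
  projᶜ : ∀ {n} → Fin n → Code n
  compᶜ : ∀ {k n} → Code k → Vec (Code n) k → Code n
  recᶜ  : ∀ {n} → Code n → Code (suc (suc n)) → Code (suc n)
  minᶜ  : ∀ {n} → Code (suc n) → Code n

infix 4 _[_]⇓_

data _[_]⇓_ : ∀ {n} → Code n → Vec ℕ n → ℕ → Set where
  ⇓zero : ∀ {n} {xs : Vec ℕ n} → zeroᶜ [ xs ]⇓ 0
  ⇓suc  : ∀ {x} → sucᶜ [ x ∷ [] ]⇓ suc x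
  ⇓proj : ∀ {n} {xs : Vec ℕ n} (i : Fin n) → projᶜ i [ xs ]⇓ lookup xs i
  ⇓comp : ∀ {k n} {c : Code k} {ds : Vec (Code n) k} {xs ys z} →
          Pointwise (λ d y → d [ xs ]⇓ y) ds ys → c [ ys ]⇓ z →
          compᶜ c ds [ xs ]⇓ z
  ⇓rec₀ : ∀ {n} {c : Code n} {d xs z} →
          c [ xs ]⇓ z → recᶜ c d [ 0 ∷ xs ]⇓ z
  ⇓rec₁ : ∀ {n} {c : Code n} {d xs k y z} →
          recᶜ c d [ k ∷ xs ]⇓ y → d [ k ∷ y ∷ xs ]⇓ z →
          recᶜ c d [ suc k ∷ xs ]⇓ z
  ⇓min  : ∀ {n} {c : Code (suc n)} {xs y} →
          (∀ z → z < y → ∃[ w ] c [ z ∷ xs ]⇓ suc w) → c [ y ∷ xs ]⇓ 0 →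
          minᶜ c [ xs ]⇓ y

Computable : ∀ {n} → (Vec ℕ n → ℕ) → Set
Computable {n} f = ∃[ c ] (∀ xs → c [ xs ]⇓ f xs)

CE : Pred ℕ 0ℓ → Set
CE A = ∃[ c ] A ≐ (λ a → ∃[ y ] c [ a ∷ [] ]⇓ y)

-- Partial functions are single-valued graphs, not assumed decidable or
-- computable, and are compared extensionally.

record PartialFunction (n : ℕ) : Set₁ where
  field
    Graph        : Vec ℕ n → ℕ → Set
    singleValued : ∀ {xs y z} → Graph xs y → Graph xs z → y ≡ z

  Dom : Pred (Vec ℕ n) 0ℓ
  Dom xs = ∃[ y ] Graph xs y

open PartialFunction public

infix 4 _≈_

_≈_ : ∀ {n} → PartialFunction n → PartialFunction n → Set
p ≈ q = ∀ xs y → Graph p xs y ⇔ Graph q xs y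

IsTotalComputable : ∀ {n} → PartialFunction n → Set
IsTotalComputable {n} q =
  Σ[ f ∈ (Vec ℕ n → ℕ) ] Computable f × (∀ xs y → Graph q xs y ⇔ f xs ≡ y)

Cube : ∀ {n} → ℕ → Pred (Vec ℕ n) 0ℓ
Cube a = All (_< a)

IsAnf : Pred ℕ 0ℓ → ∀ {n} → PartialFunction n → Set
IsAnf A q = Empty (Dom q) ⊎ (∃[ a ] A a × Dom q ≐ Cube a)

-- The disjunctions in IsAnf and 𝒮 are left as ⊎; under excluded middle they
-- are the classical ones.  Nothing here assumes excluded middle.

record 𝒮 (A : Pred ℕ 0ℓ) (n : ℕ) : Set₁ where
  field
    fun    : PartialFunction n
    member : IsTotalComputable fun ⊎ IsAnf A fun

open 𝒮 public

infix 4 _≈ˢ_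

_≈ˢ_ : ∀ {A n} → 𝒮 A n → 𝒮 A n → Set
p ≈ˢ q = fun p ≈ fun q

-- Any computable bijection ℕ × ℕ → ℕ bounding both arguments is allowed.

record Pairing : Set where
  field
    pair       : ℕ → ℕ → ℕ
    computable : Computable {2} λ { (x ∷ y ∷ []) → pair x y }
    bijective  : Bijective _≡_ _≡_ (uncurry pair)
    boundˡ     : ∀ x y → x ≤ pair x y
    boundʳ     : ∀ x y → y ≤ pair x y

  tuple : ∀ {n} → Vec ℕ (suc n) → ℕ
  tuple (x ∷ [])     = x
  tuple (x ∷ y ∷ ys) = pair x (tuple (y ∷ ys))

  ExtendedGraph : ∀ {n} → PartialFunction (suc n) → Pred ℕ 0ℓ
  ExtendedGraph {n} q =
    (λ w → Σ[ ys ∈ Vec ℕ (suc n) ] w ≡ pair (tuple ys) 0)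
    ∪ (λ w → ∃[ xs ] ∃[ y ] Graph q xs y × w ≡ pair (tuple xs) (suc y))

Range : (ℕ → ℕ) → Pred ℕ 0ℓ
Range g w = ∃[ t ] g t ≡ w

-- The partial function (i , xs) ↦ θ i xs.

universal : ∀ {A n} → (ℕ → 𝒮 A n) → PartialFunction (suc n)
universal θ .Graph (i ∷ xs) y = Graph (fun (θ i)) xs y
universal θ .singleValued {i ∷ xs} = singleValued (fun (θ i))

-- `numbering` says that θ, which takes values in 𝒮 A by its type, is onto.

record IsQuasiGödel (P : Pairing) {A : Pred ℕ 0ℓ} {n : ℕ}
                    (θ : ℕ → 𝒮 A (suc n)) : Set₁ where
  open Pairing P
  field
    numbering : Surjective _≡_ _≈ˢ_ θ
    qgnI      : Σ[ g ∈ (Vec ℕ 1 → ℕ) ] Computable g ×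
                  Range (λ t → g (t ∷ [])) ≐ ExtendedGraph (universal θ)
    qgnII     : (k : Vec ℕ 2 → ℕ) → Computable k →
                Σ[ v ∈ (Vec ℕ 1 → ℕ) ] Computable v ×
                  (∀ i (r : 𝒮 A (suc n)) →
                    Range (λ t → k (i ∷ t ∷ [])) ≐ ExtendedGraph (fun r) →
                    r ≈ˢ θ (v (i ∷ [])))

{-# OPTIONS --safe #-}

-- Kleene's diagonal argument, with θ^(m+1) in the role of a numbering of the
-- (m+1)-ary functions.  QGN I for θ^(m+1) and for θ^(n) together enumerate,
-- uniformly in x and ys, the extended graph of θ^(n) at index θ^(m+1)_x(x , ys)
-- whenever that value is defined, so QGN II yields a total computable d with
-- θ^(n)_{d(x , ys)} = θ^(n)_{θ^(m+1)_x(x , ys)} for all such x, ys.  If p is a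
-- θ^(m+1)-index of the total function (x , ys) ↦ f(d(x , ys) , ys), then
-- e(ys) = d(p , ys) is a fixed point.

module Submission where

open import Defs
open import Data.Bool.Base using (if_then_else_)
open import Data.Empty using (⊥-elim)
open import Data.Fin.Base using (Fin; suc)
open import Data.Fin.Patterns using (0F; 1F; 2F; 3F)
open import Data.Nat.Base
  using (ℕ; zero; suc; pred; _∸_; _≤_; _<_; s≤s)
open import Data.Nat.InfinitelyOften using (Inf)
open import Data.Nat.Properties
  using (_≟_; pred[m∸n]≡m∸[1+n]; n∸n≡0; m∸n≡0⇒m≤n; ≤-antisym; m≤n⇒m<n∨m≡n;
         suc-injective; 0≢1+n)
open import Data.Product.Base using (Σ-syntax; ∃-syntax; _×_; _,_; proj₁; proj₂)
open import Data.Product.Properties using (,-injective)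
open import Data.Sum.Base using (_⊎_; inj₁; inj₂)
open import Data.Vec.Base using (Vec; []; _∷_; lookup; tail; tabulate)
open import Data.Vec.Properties using (tabulate∘lookup)
open import Data.Vec.Relation.Binary.Pointwise.Inductive
  using (Pointwise; []; _∷_; tabulate⁺)
open import Function.Base using (_∘_; id)
open import Function.Bundles using (mk⇔; Equivalence)
open import Level using (0ℓ)
open import Relation.Binary.PropositionalEquality
  using (_≡_; _≢_; _≗_; refl; sym; trans; cong; cong₂; subst)
open import Relation.Nullary.Decidable using (yes; no; does; dec-true; dec-false)
open import Relation.Unary using (Pred; _≐_)

-- Closure properties of computable functions

Computables : ∀ {n k} → (Vec ℕ n → Vec ℕ k) → Set
Computables {n} {k} G =
  Σ[ ds ∈ Vec (Code n) k ] (∀ xs → Pointwise (λ d y → d [ xs ]⇓ y) ds (G xs))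

infixr 5 _∷ᶜ_
infixr 4 _∘ᶜ_

[]ᶜ : ∀ {n} → Computables {n} (λ _ → [])
[]ᶜ = [] , λ _ → []

_∷ᶜ_ : ∀ {n k} {g : Vec ℕ n → ℕ} {G : Vec ℕ n → Vec ℕ k} →
       Computable g → Computables G → Computables (λ xs → g xs ∷ G xs)
(c , c⇓) ∷ᶜ (ds , ds⇓) = c ∷ ds , λ xs → c⇓ xs ∷ ds⇓ xs

_∘ᶜ_ : ∀ {n k} {f : Vec ℕ k → ℕ} {G : Vec ℕ n → Vec ℕ k} →
       Computable f → Computables G → Computable (f ∘ G)
_∘ᶜ_ {G = G} (c , c⇓) (ds , ds⇓) = compᶜ c ds , λ xs → ⇓comp (ds⇓ xs) (c⇓ (G xs))

computable-cong : ∀ {n} {f g : Vec ℕ n → ℕ} → f ≗ g → Computable f → Computable g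
computable-cong f≗g (c , c⇓) = c , λ xs → subst (c [ xs ]⇓_) (f≗g xs) (c⇓ xs)

varᶜ : ∀ {n} (i : Fin n) → Computable (λ xs → lookup xs i)
varᶜ i = projᶜ i , λ _ → ⇓proj i

id-computable : ∀ {n} → Computables {n} id
id-computable = tabulate projᶜ , λ xs →
  subst (Pointwise _ _) (tabulate∘lookup xs) (tabulate⁺ ⇓proj)

tail-computable : ∀ {n} → Computables {suc n} tail
tail-computable = tabulate (projᶜ ∘ suc) , λ { (x ∷ xs) →
  subst (Pointwise _ _) (tabulate∘lookup xs) (tabulate⁺ (⇓proj ∘ suc)) }

suc-computable : Computable {1} λ { (x ∷ []) → suc x }
suc-computable = sucᶜ , λ { (_ ∷ []) → ⇓suc }

constᶜ : ∀ {n} a → Computable {n} (λ _ → a)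
constᶜ zero    = zeroᶜ , λ _ → ⇓zero
constᶜ (suc a) = suc-computable ∘ᶜ constᶜ a ∷ᶜ []ᶜ

-- `h` is given beforehand and only its recursion equations are checked, so functions keep their
-- usual definitions.
rec-computable : ∀ {n} {f : Vec ℕ n → ℕ} {g : Vec ℕ (suc (suc n)) → ℕ}
                 {h : Vec ℕ (suc n) → ℕ} → Computable f → Computable g →
                 (∀ xs → f xs ≡ h (0 ∷ xs)) →
                 (∀ k xs → g (k ∷ h (k ∷ xs) ∷ xs) ≡ h (suc k ∷ xs)) →
                 Computable h
rec-computable {h = h} (c , c⇓) (d , d⇓) base step =
  recᶜ c d , λ { (k ∷ xs) → converges k xs }
  where
  converges : ∀ k xs → recᶜ c d [ k ∷ xs ]⇓ h (k ∷ xs)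
  converges zero    xs = subst (recᶜ c d [ 0 ∷ xs ]⇓_) (base xs) (⇓rec₀ (c⇓ xs))
  converges (suc k) xs = subst (recᶜ c d [ suc k ∷ xs ]⇓_) (step k xs)
                           (⇓rec₁ (converges k xs) (d⇓ _))

-- Minimisation of total computable functions

IsLeastZero : (ℕ → ℕ) → ℕ → Set
IsLeastZero p y = p y ≡ 0 × (∀ z → z < y → ∃[ w ] p z ≡ suc w)

-- The recursion is on the known zero `y` while `p` is shifted. Non-zero values are recorded as
-- successors, as `⇓min` demands.
leastZero : ∀ (p : ℕ → ℕ) y → p y ≡ 0 → ∃[ z ] IsLeastZero p z
leastZero p y py≡0 with p 0 in p0
leastZero p y       py≡0 | zero  = 0 , p0 , λ _ ()
leastZero p zero    py≡0 | suc w = ⊥-elim (0≢1+n (trans (sym py≡0) p0))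
leastZero p (suc y) py≡0 | suc w =
  let z , pz≡0 , below = leastZero (p ∘ suc) y py≡0
  in suc z , pz≡0 , λ { zero _ → w , p0 ; (suc u) (s≤s u<z) → below u u<z }

minimise : ∀ {n} (p : Vec ℕ (suc n) → ℕ) → Computable p →
           (∀ xs → ∃[ y ] p (y ∷ xs) ≡ 0) →
           Σ[ μ ∈ (Vec ℕ n → ℕ) ]
             Computable μ × (∀ xs → IsLeastZero (λ y → p (y ∷ xs)) (μ xs))
minimise {n} p (c , c⇓) zeros =
  proj₁ ∘ least , (minᶜ c , converges) , proj₂ ∘ least
  where
  least : ∀ xs → ∃[ y ] IsLeastZero (λ y → p (y ∷ xs)) y
  least xs = let y , py≡0 = zeros xs in leastZero _ y py≡0

  converges : ∀ xs → minᶜ c [ xs ]⇓ proj₁ (least xs)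
  converges xs =
    let y , py≡0 , below = least xs
    in ⇓min (λ z z<y → let w , pz≡ = below z z<y
                       in w , subst (c [ z ∷ xs ]⇓_) pz≡ (c⇓ _))
            (subst (c [ y ∷ xs ]⇓_) py≡0 (c⇓ _))

-- Case distinction by equality

ifZero : ℕ → ℕ → ℕ → ℕ
ifZero zero    x y = x
ifZero (suc _) x y = y

ifZero-computable : Computable {3} λ { (a ∷ x ∷ y ∷ []) → ifZero a x y }
ifZero-computable =
  -- The step function receives the predecessor, the previous value, x and y, so 3F is y.
  rec-computable (varᶜ 0F) (varᶜ 3F)
    (λ { (_ ∷ _ ∷ []) → refl }) (λ { _ (_ ∷ _ ∷ []) → refl })

pred-computable : Computable {1} λ { (x ∷ []) → pred x }
pred-computable =
  rec-computable (constᶜ 0) (varᶜ 0F)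
    (λ { [] → refl }) (λ { _ [] → refl })

-- The arguments are swapped because `recᶜ` recurses on its first argument, here the subtrahend.
∸-computable : Computable {2} λ { (a ∷ b ∷ []) → b ∸ a }
∸-computable =
  rec-computable (varᶜ 0F)
    (pred-computable ∘ᶜ varᶜ 1F ∷ᶜ []ᶜ)
    (λ { (_ ∷ []) → refl }) (λ { a (b ∷ []) → pred[m∸n]≡m∸[1+n] b a })

abstract
  ifEq : ℕ → ℕ → ℕ → ℕ → ℕ
  ifEq a b x y = if does (a ≟ b) then x else y

  ifEq-≡ : ∀ {a b} x y → a ≡ b → ifEq a b x y ≡ x
  ifEq-≡ {a} {b} x y a≡b = cong (if_then x else y) (dec-true (a ≟ b) a≡b)

  ifEq-≢ : ∀ {a b} x y → a ≢ b → ifEq a b x y ≡ y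
  ifEq-≢ {a} {b} x y a≢b = cong (if_then x else y) (dec-false (a ≟ b) a≢b)

  -- Two numbers are equal exactly when both truncated differences vanish.
  ifEq-via-∸ : ∀ a b x y → ifZero (a ∸ b) (ifZero (b ∸ a) x y) y ≡ ifEq a b x y
  ifEq-via-∸ a b x y with a ≟ b
  ... | yes refl rewrite n∸n≡0 a = sym (ifEq-≡ {a} x y refl)
  ... | no a≢b with a ∸ b in a∸b | b ∸ a in b∸a
  ...   | suc _ | _     = sym (ifEq-≢ x y a≢b)
  ...   | zero  | suc _ = sym (ifEq-≢ x y a≢b)
  ...   | zero  | zero  = ⊥-elim (a≢b (≤-antisym (m∸n≡0⇒m≤n a∸b) (m∸n≡0⇒m≤n b∸a)))

  ifEq-computable : Computable {4} λ { (a ∷ b ∷ x ∷ y ∷ []) → ifEq a b x y }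
  ifEq-computable = computable-cong
    {f = λ xs → let a = lookup xs 0F ; b = lookup xs 1F
                    x = lookup xs 2F ; y = lookup xs 3F
                in ifZero (a ∸ b) (ifZero (b ∸ a) x y) y}
    (λ { (a ∷ b ∷ x ∷ y ∷ []) → ifEq-via-∸ a b x y })
    (ifZero-computable ∘ᶜ (∸-computable ∘ᶜ varᶜ 1F ∷ᶜ varᶜ 0F ∷ᶜ []ᶜ)
      ∷ᶜ (ifZero-computable ∘ᶜ (∸-computable ∘ᶜ varᶜ 0F ∷ᶜ varᶜ 1F ∷ᶜ []ᶜ)
            ∷ᶜ varᶜ 2F ∷ᶜ varᶜ 3F ∷ᶜ []ᶜ)
      ∷ᶜ varᶜ 3F ∷ᶜ []ᶜ)

-- Computable inverses of the pairing function

module PairingProperties (P : Pairing) where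
  open Pairing P

  pair-injective : ∀ {a b c d} → pair a b ≡ pair c d → a ≡ c × b ≡ d
  pair-injective eq = ,-injective (proj₁ bijective eq)

  pair-surjective : ∀ w → ∃[ x ] ∃[ y ] pair x y ≡ w
  pair-surjective w =
    let (x , y) , eq = proj₂ bijective w in x , y , eq refl

  private
    module Second where
      test : Vec ℕ 3 → ℕ
      test xs = let y = lookup xs 0F ; x = lookup xs 1F ; w = lookup xs 2F
                in ifEq (pair x y) w 0 (ifEq y w 0 1)

      test-computable : Computable test
      test-computable =
        ifEq-computable ∘ᶜ (computable ∘ᶜ varᶜ 1F ∷ᶜ varᶜ 0F ∷ᶜ []ᶜ)
          ∷ᶜ varᶜ 2F ∷ᶜ constᶜ 0
          ∷ᶜ (ifEq-computable ∘ᶜ varᶜ 0F ∷ᶜ varᶜ 2F ∷ᶜ constᶜ 0 ∷ᶜ constᶜ 1 ∷ᶜ []ᶜ)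
          ∷ᶜ []ᶜ

      test-bound : ∀ x w → test (w ∷ x ∷ w ∷ []) ≡ 0
      test-bound x w with pair x w ≟ w
      ... | yes eq = ifEq-≡ _ _ eq
      ... | no neq = trans (ifEq-≢ _ _ neq) (ifEq-≡ _ _ refl)

      test⇒ : ∀ y x w → test (y ∷ x ∷ w ∷ []) ≡ 0 → pair x y ≡ w ⊎ y ≡ w
      test⇒ y x w eq with pair x y ≟ w
      ... | yes p = inj₁ p
      ... | no np with y ≟ w
      ...   | yes p  = inj₂ p
      ...   | no np′ =
        ⊥-elim (0≢1+n (trans (sym eq) (trans (ifEq-≢ _ _ np) (ifEq-≢ _ _ np′))))

      -- The least y with pair x y ≡ w, cut off at w to make the search total.
      abstract
        search : Σ[ μ ∈ (Vec ℕ 2 → ℕ) ]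
                   Computable μ × (∀ xs → IsLeastZero (λ y → test (y ∷ xs)) (μ xs))
        search = minimise test test-computable
                   λ { (x ∷ w ∷ []) → w , test-bound x w }

      second : ℕ → ℕ → ℕ
      second x w = proj₁ search (x ∷ w ∷ [])

      second-computable : Computable {2} λ xs → second (lookup xs 0F) (lookup xs 1F)
      second-computable =
        proj₁ (proj₂ search) ∘ᶜ varᶜ 0F ∷ᶜ varᶜ 1F ∷ᶜ []ᶜ

      -- The cut-off is harmless: `boundʳ` gives y ≤ w, so a search that stops at w has either met y
      -- = w or passed over the zero y, against minimality.
      pair-second : ∀ {x y w} → pair x y ≡ w → pair x (second x w) ≡ w
      pair-second {x} {y} {w} eq
        with proj₂ (proj₂ search) (x ∷ w ∷ [])
      ... | zero-at , below with test⇒ (second x w) x w zero-at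
      ...   | inj₁ p = p
      ...   | inj₂ s≡w
        with m≤n⇒m<n∨m≡n (subst (y ≤_) (trans eq (sym s≡w)) (boundʳ x y))
      ...     | inj₂ y≡s = trans (cong (pair x) (sym y≡s)) eq
      ...     | inj₁ y<s =
        ⊥-elim (0≢1+n (trans (sym (ifEq-≡ _ _ eq)) (proj₂ (below y y<s))))

    module First where
      open Second using (second; second-computable; pair-second)

      -- As `second` is total, this test is computable also at those x that are not the first
      -- component of w. Surjectivity of `pair` provides a zero.
      test : Vec ℕ 2 → ℕ
      test xs = let x = lookup xs 0F ; w = lookup xs 1F
                in ifEq (pair x (second x w)) w 0 1

      test-computable : Computable test
      test-computable =
        ifEq-computable
          ∘ᶜ (computable ∘ᶜ varᶜ 0F
                ∷ᶜ (second-computable ∘ᶜ varᶜ 0F ∷ᶜ varᶜ 1F ∷ᶜ []ᶜ) ∷ᶜ []ᶜ)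
          ∷ᶜ varᶜ 1F ∷ᶜ constᶜ 0 ∷ᶜ constᶜ 1 ∷ᶜ []ᶜ

      abstract
        search : Σ[ μ ∈ (Vec ℕ 1 → ℕ) ]
                   Computable μ × (∀ xs → IsLeastZero (λ x → test (x ∷ xs)) (μ xs))
        search = minimise test test-computable
          λ { (w ∷ []) → let x , y , eq = pair-surjective w
                         in x , ifEq-≡ _ _ (pair-second eq) }

  abstract
    π₁ : ℕ → ℕ
    π₁ w = proj₁ First.search (w ∷ [])

    π₁-computable : Computable {1} λ xs → π₁ (lookup xs 0F)
    π₁-computable = proj₁ (proj₂ First.search) ∘ᶜ varᶜ 0F ∷ᶜ []ᶜ

    π₂ : ℕ → ℕ
    π₂ w = Second.second (π₁ w) w

    π₂-computable : Computable {1} λ xs → π₂ (lookup xs 0F)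
    π₂-computable = Second.second-computable ∘ᶜ π₁-computable ∷ᶜ varᶜ 0F ∷ᶜ []ᶜ

    pair-π : ∀ w → pair (π₁ w) (π₂ w) ≡ w
    pair-π w with pair (π₁ w) (π₂ w) ≟ w
    ... | yes eq = eq
    -- The test would be 1 at `π₁ w`, where the search found a zero.
    ... | no neq =
      ⊥-elim (0≢1+n (trans (sym (proj₁ (proj₂ (proj₂ First.search) (w ∷ []))))
                           (ifEq-≢ _ _ neq)))

  π₁-pair : ∀ x y → π₁ (pair x y) ≡ x
  π₁-pair x y = proj₁ (pair-injective (pair-π (pair x y)))

  π₂-pair : ∀ x y → π₂ (pair x y) ≡ y
  π₂-pair x y = proj₂ (pair-injective (pair-π (pair x y)))

  -- `tuple` matches on two entries and so does not reduce at a variable tail.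
  tuple-∷ : ∀ {n} x (ys : Vec ℕ (suc n)) → tuple (x ∷ ys) ≡ pair x (tuple ys)
  tuple-∷ x (_ ∷ _) = refl

  tuple-injective : ∀ {n} {xs ys : Vec ℕ (suc n)} → tuple xs ≡ tuple ys → xs ≡ ys
  tuple-injective {xs = _ ∷ []}    {_ ∷ []}    refl = refl
  tuple-injective {xs = _ ∷ _ ∷ _} {_ ∷ _ ∷ _} eq   =
    let eq₁ , eq₂ = pair-injective eq in cong₂ _∷_ eq₁ (tuple-injective eq₂)

  tuple-surjective : ∀ n w → Σ[ xs ∈ Vec ℕ (suc n) ] w ≡ tuple xs
  tuple-surjective zero    w = w ∷ [] , refl
  tuple-surjective (suc n) w =
    let xs , eq = tuple-surjective n (π₂ w)
    in π₁ w ∷ xs ,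
       trans (sym (pair-π w)) (trans (cong (pair (π₁ w)) eq) (sym (tuple-∷ (π₁ w) xs)))

  tuple-computable : ∀ n → Computable {suc n} tuple
  tuple-computable zero    =
    computable-cong (λ { (_ ∷ []) → refl }) (varᶜ 0F)
  tuple-computable (suc n) =
    computable-cong (λ { (x ∷ y ∷ ys) → refl })
      (computable ∘ᶜ varᶜ 0F ∷ᶜ (tuple-computable n ∘ᶜ tail-computable) ∷ᶜ []ᶜ)

  -- Every number codes a tuple of the given arity, so these padding elements lie in all extended
  -- graphs alike and are always safe to emit.
  pair-0∈ExtendedGraph : ∀ {n} (q : PartialFunction (suc n)) w →
                         ExtendedGraph q (pair w 0)
  pair-0∈ExtendedGraph {n} q w =
    let ys , eq = tuple-surjective n w in inj₁ (ys , cong (λ v → pair v 0) eq)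

  pair-suc∈ExtendedGraph : ∀ {n} (q : PartialFunction (suc n)) {xs y} →
                           ExtendedGraph q (pair (tuple xs) (suc y)) → Graph q xs y
  pair-suc∈ExtendedGraph q (inj₁ (_ , eq)) =
    ⊥-elim (0≢1+n (sym (proj₂ (pair-injective eq))))
  pair-suc∈ExtendedGraph q (inj₂ (_ , _ , qxy , eq)) =
    let eq₁ , eq₂ = pair-injective eq
    in subst (λ z → Graph q z _) (sym (tuple-injective eq₁))
         (subst (Graph q _) (sym (suc-injective eq₂)) qxy)

  -- The diagonal function

  module Diagonal {A : Pred ℕ 0ℓ} {m n : ℕ}
                  {η : ℕ → 𝒮 A (suc (suc m))} {θ : ℕ → 𝒮 A (suc n)}
                  (ηQ : IsQuasiGödel P η) (θQ : IsQuasiGödel P θ) where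
    private
      module η = IsQuasiGödel ηQ
      module θ = IsQuasiGödel θQ

      g₁ g₂ : ℕ → ℕ
      g₁ s = proj₁ η.qgnI (s ∷ [])
      g₂ u = proj₁ θ.qgnI (u ∷ [])

      g₁-range : Range g₁ ≐ ExtendedGraph (universal η)
      g₁-range = proj₂ (proj₂ η.qgnI)

      g₂-range : Range g₂ ≐ ExtendedGraph (universal θ)
      g₂-range = proj₂ (proj₂ θ.qgnI)

      -- For i = ⟨x , ys⟩ and g₂ u = ⟨⟨z , xs⟩ , b⟩, the test says that g₁ s
      -- witnesses η_x(x , ys) = z; then ⟨⟨xs⟩ , b⟩ is in the extended graph of
      -- θ_z (also when b = 0).
      emit : ℕ → ℕ → ℕ → ℕ → ℕ
      emit i w s u =
        ifEq (g₁ s) (pair (pair (π₁ i) i) (suc (π₁ (π₁ (g₂ u)))))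
             (pair (π₂ (π₁ (g₂ u))) (π₂ (g₂ u)))
             (pair w 0)

      -- The number t codes w, s and u independently, so every value of `g₁` meets every value of
      -- `g₂`, with every w as fallback.
      enum : ℕ → ℕ → ℕ
      enum i t = emit i (π₁ t) (π₁ (π₂ t)) (π₂ (π₂ t))

      enum-pair : ∀ i w s u → enum i (pair w (pair s u)) ≡ emit i w s u
      enum-pair i w s u
        rewrite π₁-pair w (pair s u) | π₂-pair w (pair s u)
              | π₁-pair s u | π₂-pair s u = refl

      enum-computable : Computable {2} λ xs → enum (lookup xs 0F) (lookup xs 1F)
      enum-computable =
        ifEq-computable ∘ᶜ (proj₁ (proj₂ η.qgnI) ∘ᶜ fst (snd t) ∷ᶜ []ᶜ)
          ∷ᶜ (computable ∘ᶜ (computable ∘ᶜ fst i ∷ᶜ i ∷ᶜ []ᶜ)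
                ∷ᶜ (suc-computable ∘ᶜ fst (fst g₂u) ∷ᶜ []ᶜ) ∷ᶜ []ᶜ)
          ∷ᶜ (computable ∘ᶜ snd (fst g₂u) ∷ᶜ snd g₂u ∷ᶜ []ᶜ)
          ∷ᶜ (computable ∘ᶜ fst t ∷ᶜ constᶜ 0 ∷ᶜ []ᶜ)
          ∷ᶜ []ᶜ
        where
        fst : ∀ {n} {f : Vec ℕ n → ℕ} → Computable f → Computable (π₁ ∘ f)
        fst c = π₁-computable ∘ᶜ c ∷ᶜ []ᶜ
        snd : ∀ {n} {f : Vec ℕ n → ℕ} → Computable f → Computable (π₂ ∘ f)
        snd c = π₂-computable ∘ᶜ c ∷ᶜ []ᶜ
        i : Computable {2} λ xs → lookup xs 0F
        i = varᶜ 0F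
        t : Computable {2} λ xs → lookup xs 1F
        t = varᶜ 1F
        g₂u : Computable {2} λ xs → g₂ (π₂ (π₂ (lookup xs 1F)))
        g₂u = proj₁ (proj₂ θ.qgnI) ∘ᶜ snd (snd t) ∷ᶜ []ᶜ

      v : ℕ → ℕ
      v i = proj₁ (θ.qgnII _ enum-computable) (i ∷ [])

    -- QGN II yields a total `v`, so this has a value even where η_x(x , ys) is undefined;
    -- `diagonal-≈` speaks only of the defined case.
    diagonal : Vec ℕ (suc (suc m)) → ℕ
    diagonal xs = v (tuple xs)

    diagonal-computable : Computable diagonal
    diagonal-computable =
      proj₁ (proj₂ (θ.qgnII _ enum-computable)) ∘ᶜ tuple-computable (suc m) ∷ᶜ []ᶜ

    module _ {x z} {ys : Vec ℕ (suc m)} (ηx≡z : Graph (fun (η x)) (x ∷ ys) z) where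
      private
        i : ℕ
        i = tuple (x ∷ ys)

        -- Pairing i with its own first component duplicates x: this is the self-application in the
        -- diagonal argument.
        key : pair (π₁ i) i ≡ tuple (x ∷ x ∷ ys)
        key = cong (λ a → pair a i) (trans (cong π₁ (tuple-∷ x ys)) (π₁-pair x (tuple ys)))

        -- Deleting the index z from an element of the extended graph of `universal θ` leaves an
        -- element of that of `θ z`; padding stays padding.
        matching-sound : ∀ u → π₁ (π₁ (g₂ u)) ≡ z →
                         ExtendedGraph (fun (θ z)) (pair (π₂ (π₁ (g₂ u))) (π₂ (g₂ u)))
        matching-sound u z≡ with g₂ u | proj₁ g₂-range (u , refl)
        ... | _ | inj₁ (xs , refl) rewrite π₂-pair (tuple xs) 0 =
          pair-0∈ExtendedGraph (fun (θ z)) _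
        ... | _ | inj₂ (z′ ∷ xs , y , θxy , refl)
          rewrite π₁-pair (tuple (z′ ∷ xs)) (suc y) | π₂-pair (tuple (z′ ∷ xs)) (suc y)
                | tuple-∷ z′ xs | π₁-pair z′ (tuple xs) | π₂-pair z′ (tuple xs)
                | z≡ = inj₂ (xs , y , θxy , refl)

        -- If the test succeeds, `g₁ s` attests that η_x(x , ys) is the index read off `g₂ u`, and
        -- single-valuedness makes this index z. If it fails, padding is emitted.
        emit-sound : ∀ w s u → ExtendedGraph (fun (θ z)) (emit i w s u)
        emit-sound w s u
          with g₁ s ≟ pair (pair (π₁ i) i) (suc (π₁ (π₁ (g₂ u))))
        ... | no neq =
          subst (ExtendedGraph (fun (θ z))) (sym (ifEq-≢ _ _ neq))
            (pair-0∈ExtendedGraph (fun (θ z)) w)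
        ... | yes eq =
          subst (ExtendedGraph (fun (θ z))) (sym (ifEq-≡ _ _ eq))
            (matching-sound u (singleValued (fun (η x))
              (pair-suc∈ExtendedGraph (universal η) {x ∷ x ∷ ys}
                (proj₁ g₁-range (s , trans eq
                  (cong (λ a → pair a (suc (π₁ (π₁ (g₂ u))))) key))))
              ηx≡z))

        enum-complete : ∀ {w} → ExtendedGraph (fun (θ z)) w → Range (enum i) w
        enum-complete (inj₁ (xs , refl)) =
          -- To emit padding, the test must fail: s is chosen so that `g₁ s` is itself padding,
          -- whose second component 0 is no successor. The choice of 0 for u is arbitrary.
          let s , g₁s≡ = proj₂ g₁-range (pair-0∈ExtendedGraph (universal η) 0)
          in pair (tuple xs) (pair s 0) ,
             trans (enum-pair i _ s 0)
               (ifEq-≢ _ _ λ eq → 0≢1+n (proj₂ (pair-injective (trans (sym g₁s≡) eq))))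
        enum-complete (inj₂ (xs , y , θxy , refl)) =
          -- Here s attests η_x(x , ys) = z and u attests θ_z(xs) = y, so the test succeeds.
          let s , g₁s≡ = proj₂ g₁-range (inj₂ (x ∷ x ∷ ys , z , ηx≡z , refl))
              u , g₂u≡ = proj₂ g₂-range (inj₂ (z ∷ xs , y , θxy , refl))
              first≡  = trans (cong π₁ g₂u≡) (trans (π₁-pair _ _) (tuple-∷ z xs))
              z≡      = trans (cong π₁ first≡) (π₁-pair z (tuple xs))
              xs≡     = trans (cong π₂ first≡) (π₂-pair z (tuple xs))
              y≡      = trans (cong π₂ g₂u≡) (π₂-pair _ _)
          in pair 0 (pair s u) ,
             trans (enum-pair i 0 s u)
               (trans (ifEq-≡ _ _ (trans g₁s≡ (sym (cong₂ pair key (cong suc z≡)))))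
                      (cong₂ pair xs≡ y≡))

      -- `θ z` is already a member of `𝒮`, so QGN II applies with r = `θ z`; the two inclusions are
      -- soundness and completeness of `enum`.
      diagonal-≈ : θ z ≈ˢ θ (diagonal (x ∷ ys))
      diagonal-≈ = proj₂ (proj₂ (θ.qgnII _ enum-computable)) i (θ z)
        ((λ { (t , refl) → emit-sound (π₁ t) (π₁ (π₂ t)) (π₂ (π₂ t)) }) , enum-complete)

-- The fixed point

total : ∀ {A n} (f : Vec ℕ n → ℕ) → Computable f → 𝒮 A n
total f fᶜ .fun .Graph xs y             = f xs ≡ y
total f fᶜ .fun .singleValued refl refl = refl
total f fᶜ .member = inj₁ (f , fᶜ , λ _ _ → mk⇔ id id)

theorem4p9 : (P : Pairing) (A : Pred ℕ 0ℓ) → Inf A → CE A →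
    (θ : ∀ n → ℕ → 𝒮 A (suc n)) → (∀ n → IsQuasiGödel P (θ n)) →
    ∀ m n (f : Vec ℕ (suc (suc m)) → ℕ) → Computable f →
    Σ[ e ∈ (Vec ℕ (suc m) → ℕ) ]
    Computable e × (∀ ys → θ n (f (e ys ∷ ys)) ≈ˢ θ n (e ys))
theorem4p9 P A _ _ θ θQ m n f fᶜ =
  (λ ys → diagonal (p ∷ ys)) ,
  (diagonal-computable ∘ᶜ constᶜ p ∷ᶜ id-computable) ,
  -- At x = p the value η_p(p , ys) is h(p , ys), which unfolds to f(e(ys) , ys); `diagonal-≈` is
  -- applied with this z.
  λ ys → diagonal-≈ (Equivalence.from (θp≈h (p ∷ ys) _) refl)
  where
  open PairingProperties P
  open Diagonal (θQ (suc m)) (θQ n)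

  h : Vec ℕ (suc (suc m)) → ℕ
  -- The entry x reaches `f` only through `diagonal`; the parameters ys are the tail.
  h xs = f (diagonal xs ∷ tail xs)

  h-computable : Computable h
  h-computable = fᶜ ∘ᶜ diagonal-computable ∷ᶜ tail-computable

  h-index : ∃[ p ] (∀ {q} → q ≡ p → θ (suc m) q ≈ˢ total h h-computable)
  h-index = IsQuasiGödel.numbering (θQ (suc m)) (total h h-computable)

  p : ℕ
  p = proj₁ h-index

  θp≈h : θ (suc m) p ≈ˢ total h h-computable
  θp≈h = proj₂ h-index refl
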